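{- $r_5(6,6) \ge 72$.
   Context: For integers $k,p,q$, the Ramsey number $r_k(p,q)$ is the smallest integer $N$ such that for every coloring of all $k$-element subsets of $\{1,\dots,N\}$ with the colors red and blue, there exist either $p$ elements of $\{1,\dots,N\}$ all of whose $k$-element subsets are red, or $q$ elements of $\{1,\dots,N\}$ all of whose $k$-element subsets are blue. -}

module Defs where

open import Data.Nat using (ℕ; _≤_)
open import Data.Fin.Subset using (Subset; _⊆_; ∣_∣)
open import Data.Product using (Σ; ∃; _×_; _,_)
open import Data.Sum using (_⊎_)
open import Relation.Binary.PropositionalEquality using (_≡_)

data Colour : Set where
  red blue : Colour

-- The ground set {1,…,N} is represented by Fin N. The size component is a
-- proposition (≡ on ℕ is proof-irrelevant), so this is exactly the set of
-- k-element subsets.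
KSubset : ℕ → ℕ → Set
KSubset k N = Σ (Subset N) λ S → ∣ S ∣ ≡ k

Colouring : ℕ → ℕ → Set
Colouring k N = KSubset k N → Colour

Monochromatic : ∀ {k N} → Colouring k N → Colour → Subset N → Set
Monochromatic {k} {N} χ c T =
  ∀ (S : Subset N) (∣S∣≡k : ∣ S ∣ ≡ k) → S ⊆ T → χ (S , ∣S∣≡k) ≡ c

RamseyProperty : (k p q N : ℕ) → Set
RamseyProperty k p q N = ∀ (χ : Colouring k N) →
    (∃ λ (T : Subset N) → ∣ T ∣ ≡ p × Monochromatic χ red T)
  ⊎ (∃ λ (T : Subset N) → ∣ T ∣ ≡ q × Monochromatic χ blue T)

-- "r = r_k(p,q)". The Ramsey number is given by its graph: r is unique because
-- ≤ is antisymmetric, and it exists by Ramsey's theorem, which is not proved here.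
IsRamseyNumber : (k p q r : ℕ) → Set
IsRamseyNumber k p q r =
  RamseyProperty k p q r × (∀ N → RamseyProperty k p q N → r ≤ N)

{-# OPTIONS --safe #-}
module Submission where

-- A colouring of the 5-subsets of the field F of residues modulo 71 is exhibited in
-- which every 6-subset contains 5-subsets of both colours. Restricting it to
-- {0,…,N-1} refutes the Ramsey property for every N ≤ 71.
--
-- The colouring is invariant under the group G of maps z ↦ s z + t with s a nonzero
-- square. Since 2 generates the squares modulo 71 and -1 is not a square, G has order
-- 35 · 71 and carries every pair of points to {0,1} in exactly one way. G has 23 orbits
-- on triples of points. Each orbit has a numerical weight, constant on it and different
-- from the weights of the other orbits, and the colour of a 5-set is looked up in a
-- fixed table, at the sum of the weights of its ten triples modulo 16384. This makes
-- the colour symmetric and G-invariant by construction. The table itself has no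
-- structure: it comes from a local search over the roughly 57600 constraints, one for
-- each orbit of 6-sets, that the 5-subsets of a 6-set are not all of one colour.
--
-- That the table satisfies the constraints is verified by computation, after a reduction.
-- A 6-set contains a triple of least weight among those met by exchanging one of its
-- points (lightest-triple), and G moves this triple to {0,1,r} for one of 23 values r
-- (normalisable). The other three points are then among those z for which no triple
-- formed by z and two of 0, 1, r is lighter than {0,1,r}. A depth-first
-- search (noClique, sound by noClique-sound) shows that no three such points extend
-- {0,1,r} to a 6-set all of whose 5-subsets have one colour.

open import Algebra.Properties.CommutativeSemigroup using (interchange; x∙yz≈y∙xz)
open import Data.Bool.Base using (Bool; true; false; _∧_; _∨_; if_then_else_; T)
open import Data.Bool.ListAction using (all; any)
open import Data.Bool.Properties using (T?; T-∧; T-∨)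
open import Data.Empty using (⊥)
open import Data.Fin.Subset using (Subset; inside; outside; _⊆_; ∣_∣)
open import Data.Fin.Subset.Properties using (⊆-refl; out⊆; in⊆in)
open import Data.List.Base using (List; []; _∷_; _++_; map; filter; upTo; length; foldr)
open import Data.List.Membership.Propositional using (_∈_; find)
open import Data.List.Membership.Propositional.Properties
  using (∈-∃++; ∈-filter⁺; ∈-upTo⁺; ∈-++⁻; ∈-map⁻)
open import Data.List.Properties using (length-++; length-map; ++-identityʳ)
open import Data.List.Relation.Binary.Permutation.Propositional as Perm
  using (_↭_; ↭-refl; ↭-sym; ↭-trans; ↭-reflexive; prep; swap; ↭⇒↭ₛ; module PermutationReasoning)
open import Data.List.Relation.Binary.Permutation.Propositional.Properties
  using (∈-resp-↭; ↭-map-inv; ↭-length; shift; drop-∷; ++⁺ˡ; ++⁺ʳ; ++-assoc)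
open import Data.List.Relation.Binary.Permutation.Setoid.Properties using (AllPairs-resp-↭)
open import Data.List.Relation.Unary.All as All using (All; []; _∷_)
open import Data.List.Relation.Unary.All.Properties using (all⁺; ¬All⇒Any¬) renaming (map⁺ to All-map⁺)
open import Data.List.Relation.Unary.AllPairs as AllPairs using (AllPairs; []; _∷_)
import Data.List.Relation.Unary.AllPairs.Properties as AllPairsₚ
open import Data.List.Relation.Unary.Any as Any using (here; there)
open import Data.List.Relation.Unary.Any.Properties using (any⁻)
open import Data.List.Relation.Unary.Unique.Propositional using (Unique)
open import Data.Nat
  using (ℕ; zero; suc; _+_; _*_; _∸_; _^_; _%_; _/_; _<ᵇ_; _≤ᵇ_; _≡ᵇ_; _≤_; _<_; _≥_; s≤s)
open import Data.Nat.DivMod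
  using (%-distribˡ-+; %-distribˡ-*; m%n%n≡m%n; m%n<n; m<n⇒m%n≡m; [m+kn]%n≡m%n)
open import Data.Nat.Induction using (Acc; acc; <-wellFounded)
open import Data.Nat.Properties
open import Data.Nat.Tactic.RingSolver using (solve-∀)
open import Data.Product using (∃; _×_; _,_; proj₁; proj₂)
open import Data.Sum using (_⊎_; inj₁; inj₂; [_,_]′)
open import Data.Vec.Base using ([]; _∷_)
open import Data.List.Membership.DecPropositional _≟_ using (_∈?_)
open import Function.Base using (_∘_)
open import Function.Bundles using (Equivalence)
open import Relation.Binary.PropositionalEquality
  using (_≡_; _≢_; refl; sym; trans; cong; cong₂; subst; subst₂; setoid; resp₂; module ≡-Reasoning)
open import Relation.Nullary using (Dec; ¬_; yes; no; contradiction)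
open import Relation.Nullary.Decidable using (_×-dec_; map′)
open import Defs

-- Arithmetic modulo 71

%-cong-+ : ∀ a a′ b b′ → a % 71 ≡ a′ % 71 → b % 71 ≡ b′ % 71 → (a + b) % 71 ≡ (a′ + b′) % 71
%-cong-+ a a′ b b′ p q =
  trans (%-distribˡ-+ a b 71) (trans (cong₂ (λ x y → (x + y) % 71) p q) (sym (%-distribˡ-+ a′ b′ 71)))

%-congˡ-* : ∀ s a a′ → a % 71 ≡ a′ % 71 → (a * s) % 71 ≡ (a′ * s) % 71
%-congˡ-* s a a′ p =
  trans (%-distribˡ-* a s 71) (trans (cong (λ x → (x * (s % 71)) % 71) p) (sym (%-distribˡ-* a′ s 71)))

%-idem : ∀ a → a % 71 % 71 ≡ a % 71
%-idem a = m%n%n≡m%n a 71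

%-drop : ∀ {m} n k → m ≡ n + k * 71 → m % 71 ≡ n % 71
%-drop n k refl = [m+kn]%n≡m%n n k 71

-- The residue of b - a modulo 71; multiplication by 70 is negation, which avoids
-- truncated subtraction and makes diff meaningful for all natural numbers.
diff : ℕ → ℕ → ℕ
diff a b = (b + a * 70) % 71

diff<71 : ∀ a b → diff a b < 71
diff<71 a b = m%n<n (b + a * 70) 71

diff-self : ∀ a → diff a a ≡ 0
diff-self a = %-drop 0 a (lem a)
  where
  lem : ∀ a → a + a * 70 ≡ 0 + a * 71
  lem = solve-∀

diff≡0⇒≡ : ∀ a b → diff a b ≡ 0 → a % 71 ≡ b % 71
diff≡0⇒≡ a b eq = begin
  a % 71                    ≡⟨ %-cong-+ 0 (b + a * 70) a a (sym eq) refl ⟩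
  ((b + a * 70) + a) % 71   ≡⟨ %-drop b a (lem a b) ⟩
  b % 71                    ∎
  where
  open ≡-Reasoning
  lem : ∀ a b → (b + a * 70) + a ≡ b + a * 71
  lem = solve-∀

diff-swap : ∀ a b → diff b a ≡ (diff a b * 70) % 71
diff-swap a b = sym (begin
  (diff a b * 70) % 71        ≡⟨ %-congˡ-* 70 (diff a b) (b + a * 70) (%-idem (b + a * 70)) ⟩
  ((b + a * 70) * 70) % 71    ≡⟨ %-drop (a + b * 70) (a * 69) (lem a b) ⟩
  diff b a                    ∎)
  where
  open ≡-Reasoning
  lem : ∀ a b → (b + a * 70) * 70 ≡ a + b * 70 + a * 69 * 71
  lem = solve-∀

diff-shift : ∀ a b c → diff (diff a b) (diff a c) ≡ diff b c
diff-shift a b c = begin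
  (diff a c + diff a b * 70) % 71
    ≡⟨ %-cong-+ (diff a c) (c + a * 70) (diff a b * 70) _ (%-idem (c + a * 70))
       (%-congˡ-* 70 (diff a b) (b + a * 70) (%-idem (b + a * 70))) ⟩
  ((c + a * 70) + (b + a * 70) * 70) % 71
    ≡⟨ %-drop (c + b * 70) (a * 70) (lem a b c) ⟩
  diff b c ∎
  where
  open ≡-Reasoning
  lem : ∀ a b c → (c + a * 70) + (b + a * 70) * 70 ≡ c + b * 70 + a * 70 * 71
  lem = solve-∀

-- The element z ↦ 2ᵏ (z - a) of G, with values reduced modulo 71.
affine : ℕ → ℕ → ℕ → ℕ
affine k a z = ((z + a * 70) * 2 ^ k) % 71

affine-diff : ∀ k a z → affine k a z ≡ (diff a z * 2 ^ k) % 71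
affine-diff k a z = %-congˡ-* (2 ^ k) (z + a * 70) (diff a z) (sym (%-idem (z + a * 70)))

affine-base : ∀ k a → affine k a a ≡ 0
affine-base k a = trans (affine-diff k a a) (cong (λ d → (d * 2 ^ k) % 71) (diff-self a))

diff-affine : ∀ k a u v → diff (affine k a u) (affine k a v) ≡ (diff u v * 2 ^ k) % 71
diff-affine k a u v = begin
  (affine k a v + affine k a u * 70) % 71
    ≡⟨ %-cong-+ (affine k a v) ((v + a * 70) * s) (affine k a u * 70) _ (%-idem ((v + a * 70) * s))
       (%-congˡ-* 70 (affine k a u) ((u + a * 70) * s) (%-idem ((u + a * 70) * s))) ⟩
  ((v + a * 70) * s + ((u + a * 70) * s) * 70) % 71
    ≡⟨ %-drop ((v + u * 70) * s) (s * 70 * a) (lem s a u v) ⟩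
  ((v + u * 70) * s) % 71
    ≡⟨ %-congˡ-* s (v + u * 70) (diff u v) (sym (%-idem (v + u * 70))) ⟩
  (diff u v * s) % 71 ∎
  where
  open ≡-Reasoning
  s = 2 ^ k
  lem : ∀ s a u v → (v + a * 70) * s + ((u + a * 70) * s) * 70 ≡ (v + u * 70) * s + s * 70 * a * 71
  lem = solve-∀

-- 36 is the inverse of 2 modulo 71.
double-injective : ∀ u v → (u * 2) % 71 ≡ (v * 2) % 71 → u % 71 ≡ v % 71
double-injective u v eq = begin
  u % 71               ≡⟨ %-drop u u (lem u) ⟨
  ((u * 2) * 36) % 71  ≡⟨ %-congˡ-* 36 (u * 2) (v * 2) eq ⟩
  ((v * 2) * 36) % 71  ≡⟨ %-drop v v (lem v) ⟩
  v % 71               ∎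
  where
  open ≡-Reasoning
  lem : ∀ u → (u * 2) * 36 ≡ u + u * 71
  lem = solve-∀

*1-reduced : ∀ w → w < 71 → (w * 1) % 71 ≡ w
*1-reduced w w< = trans (cong (_% 71) (*-identityʳ w)) (m<n⇒m%n≡m w<)

power-step : ∀ k u → (((u * 2) % 71) * 2 ^ k) % 71 ≡ (u * 2 ^ suc k) % 71
power-step k u = trans (%-congˡ-* (2 ^ k) ((u * 2) % 71) (u * 2) (%-idem (u * 2))) (cong (_% 71) (lem (2 ^ k) u))
  where
  lem : ∀ s u → u * 2 * s ≡ u * (2 * s)
  lem = solve-∀

power-injective : ∀ k u v → (u * 2 ^ k) % 71 ≡ (v * 2 ^ k) % 71 → u % 71 ≡ v % 71
power-injective zero    u v eq =
  trans (cong (_% 71) (sym (*-identityʳ u))) (trans eq (cong (_% 71) (*-identityʳ v)))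
power-injective (suc k) u v eq = power-injective k u v (double-injective (u * 2 ^ k) (v * 2 ^ k)
  (trans (cong (_% 71) (sym (lem u (2 ^ k)))) (trans eq (cong (_% 71) (lem v (2 ^ k))))))
  where
  lem : ∀ u s → u * (2 * s) ≡ u * s * 2
  lem = solve-∀

affine-injective : ∀ k a u v → affine k a u ≡ affine k a v → u % 71 ≡ v % 71
affine-injective k a u v eq = begin
  u % 71               ≡⟨ %-drop u a (lem u a) ⟨
  ((u + a * 70) + a) % 71
    ≡⟨ %-cong-+ (u + a * 70) (v + a * 70) a a (power-injective k (u + a * 70) (v + a * 70) eq) refl ⟩
  ((v + a * 70) + a) % 71  ≡⟨ %-drop v a (lem v a) ⟩
  v % 71               ∎
  where
  open ≡-Reasoning
  lem : ∀ u a → (u + a * 70) + a ≡ u + a * 71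
  lem = solve-∀

-- Lookup trees, colours and lists

-- Finite tables indexed by natural numbers. A node n l r holds the entries below n in l
-- and the others, with indices shifted down by n, in r.
data Tree (A : Set) : Set where
  leaf : A → Tree A
  node : ℕ → Tree A → Tree A → Tree A

get : ∀ {A} → Tree A → ℕ → A
get (leaf a)     i = a
get (node n l r) i = if i <ᵇ n then get l i else get r (i ∸ n)

sameColour : Colour → Colour → Bool
sameColour red  red  = true
sameColour blue blue = true
sameColour _    _    = false

sameColour-refl : ∀ c → T (sameColour c c)
sameColour-refl red  = _
sameColour-refl blue = _

-- All ways of choosing k entries of a list, in order.
choose : ∀ {A : Set} → ℕ → List A → List (List A)
choose zero    _        = [] ∷ []
choose (suc k) []       = []
choose (suc k) (x ∷ xs) = map (x ∷_) (choose k xs) ++ choose (suc k) xs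

∈-choose⁻ : ∀ {A : Set} k (l : List A) {q} → q ∈ choose k l → length q ≡ k × ∃ λ m → q ++ m ↭ l
∈-choose⁻ zero l (here refl) = refl , l , ↭-refl
∈-choose⁻ (suc k) (x ∷ l) q∈ with ∈-++⁻ (map (x ∷_) (choose k l)) q∈
... | inj₁ q∈map with q′ , q′∈ , refl ← ∈-map⁻ (x ∷_) q∈map
                 with len , m , p ← ∈-choose⁻ k l q′∈ = cong suc len , m , prep x p
... | inj₂ q∈rest with len , m , p ← ∈-choose⁻ (suc k) l q∈rest =
  len , x ∷ m , ↭-trans (shift x _ m) (prep x p)

≡true⇒T : ∀ {b} → b ≡ true → T b
≡true⇒T refl = _

all-complete : ∀ {A : Set} (p : A → Bool) xs → (∀ x → x ∈ xs → T (p x)) → T (all p xs)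
all-complete p []       h = _
all-complete p (x ∷ xs) h = Equivalence.from T-∧ (h x (here refl) , all-complete p xs (λ y y∈ → h y (there y∈)))

all-sound : ∀ {A : Set} (p : A → Bool) xs → T (all p xs) → ∀ {x} → x ∈ xs → T (p x)
all-sound p xs t = All.lookup (all⁺ p xs t)

∈⇒↭ : ∀ {A : Set} {x : A} {l} → x ∈ l → ∃ λ m → l ↭ x ∷ m
∈⇒↭ x∈l with ys , zs , refl ← ∈-∃++ x∈l = ys ++ zs , shift _ ys zs

-- The entries are pairwise incongruent modulo 71.
Distinct : List ℕ → Set
Distinct = AllPairs (λ a b → a % 71 ≢ b % 71)

Distinct-resp-↭ : ∀ {l m} → l ↭ m → Distinct l → Distinct m
Distinct-resp-↭ p = AllPairs-resp-↭ (setoid ℕ) (λ a≢b b≡a → a≢b (sym b≡a)) (resp₂ _) (↭⇒↭ₛ p)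

Unique-resp-↭ : ∀ {l m : List ℕ} → l ↭ m → Unique l → Unique m
Unique-resp-↭ p = AllPairs-resp-↭ (setoid ℕ) (λ a≢b b≡a → a≢b (sym b≡a)) (resp₂ _) (↭⇒↭ₛ p)

distinct : ∀ {l} → All (_< 71) l → Unique l → Distinct l
distinct []        []        = []
distinct (a< ∷ l<) (a≢ ∷ u) = All.zipWith separate (l< , a≢) ∷ distinct l< u
  where
  separate : ∀ {b} → b < 71 × _ ≢ b → _ ≢ b % 71
  separate (b< , a≢b) eq = a≢b (trans (sym (m<n⇒m%n≡m a<)) (trans eq (m<n⇒m%n≡m b<)))

-- Elements of subsets

-- The elements of S in increasing order, the ground set being numbered from k.
elements : ∀ {N} → ℕ → Subset N → List ℕ
elements k []            = []
elements k (inside  ∷ S) = k ∷ elements (suc k) S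
elements k (outside ∷ S) = elements (suc k) S

length-elements : ∀ {N} k (S : Subset N) → length (elements k S) ≡ ∣ S ∣
length-elements k []            = refl
length-elements k (inside  ∷ S) = cong suc (length-elements (suc k) S)
length-elements k (outside ∷ S) = length-elements (suc k) S

elements-≥ : ∀ {N} k (S : Subset N) → All (k ≤_) (elements k S)
elements-≥ k []            = []
elements-≥ k (inside  ∷ S) = ≤-refl ∷ All.map (≤-trans (n≤1+n k)) (elements-≥ (suc k) S)
elements-≥ k (outside ∷ S) = All.map (≤-trans (n≤1+n k)) (elements-≥ (suc k) S)

elements-< : ∀ {N} k (S : Subset N) → All (_< k + N) (elements k S)
elements-< k []                    = []
elements-< {suc N} k (inside  ∷ S) rewrite +-suc k N = s≤s (m≤m+n k N) ∷ elements-< (suc k) S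
elements-< {suc N} k (outside ∷ S) rewrite +-suc k N = elements-< (suc k) S

elements-unique : ∀ {N} k (S : Subset N) → Unique (elements k S)
elements-unique k []            = []
elements-unique k (inside  ∷ S) = All.map <⇒≢ (elements-≥ (suc k) S) ∷ elements-unique (suc k) S
elements-unique k (outside ∷ S) = elements-unique (suc k) S

-- The subset S with the element x removed.
delete : ∀ {N} k (S : Subset N) {x} → x ∈ elements k S →
  ∃ λ R → R ⊆ S × x ∷ elements k R ↭ elements k S
delete k (inside ∷ S) (here refl) = outside ∷ S , out⊆ ⊆-refl , ↭-refl
delete k (inside ∷ S) (there x∈) with R , R⊆S , p ← delete (suc k) S x∈ =
  inside ∷ R , in⊆in R⊆S , ↭-trans (swap _ k ↭-refl) (prep k p)
delete k (outside ∷ S) x∈ with R , R⊆S , p ← delete (suc k) S x∈ =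
  outside ∷ R , out⊆ R⊆S , p

-- Sums over triples

-- Weights of triples of natural numbers; the weight of a list is the sum of the weights
-- of its triples.
module TripleSum (weight : ℕ → ℕ → ℕ → ℕ) where

  -- sum₁ a b l, sum₂ a l and sum₃ l add up the weights of the triples a, b, x with x in l,
  -- of the triples a, x, y with x, y in l, and of the triples in l.
  sum₁ : ℕ → ℕ → List ℕ → ℕ
  sum₁ a b []      = 0
  sum₁ a b (c ∷ l) = weight a b c + sum₁ a b l

  sum₂ : ℕ → List ℕ → ℕ
  sum₂ a []      = 0
  sum₂ a (b ∷ l) = sum₁ a b l + sum₂ a l

  sum₃ : List ℕ → ℕ
  sum₃ []      = 0
  sum₃ (a ∷ l) = sum₂ a l + sum₃ l

  -- Exchanging one point of the triple a, b, c for z does not make it lighter.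
  record Lightest (a b c z : ℕ) : Set where
    constructor light
    field
      abz : weight a b c ≤ weight a b z
      acz : weight a b c ≤ weight a c z
      bcz : weight a b c ≤ weight b c z

  -- As long as some exchange makes the triple lighter, it is carried out; this terminates
  -- because the weight decreases.
  lightest-triple : ∀ a b c rest → Acc _<_ (weight a b c) →
    ∃ λ a′ → ∃ λ b′ → ∃ λ c′ → ∃ λ rest′ →
      (a ∷ b ∷ c ∷ rest ↭ a′ ∷ b′ ∷ c′ ∷ rest′) × All (Lightest a′ b′ c′) rest′
  lightest-triple a b c rest (acc rec) = decide
    where
    Goal = ∃ λ a′ → ∃ λ b′ → ∃ λ c′ → ∃ λ rest′ →
      (a ∷ b ∷ c ∷ rest ↭ a′ ∷ b′ ∷ c′ ∷ rest′) × All (Lightest a′ b′ c′) rest′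
    replace : ∀ x y z {m} → weight x y z < weight a b c → a ∷ b ∷ c ∷ rest ↭ x ∷ y ∷ z ∷ m → Goal
    replace x y z {m} lt p with a′ , b′ , c′ , m′ , q , h ← lightest-triple x y z m (rec lt) =
      a′ , b′ , c′ , m′ , ↭-trans p q , h
    lightest? : ∀ z → Dec (Lightest a b c z)
    lightest? z = map′ (λ (p , q , r) → light p q r) (λ (light p q r) → p , q , r)
        ((weight a b c ≤? weight a b z) ×-dec (weight a b c ≤? weight a c z) ×-dec (weight a b c ≤? weight b c z))
    decide : Goal
    decide with All.all? lightest? rest
    ... | yes h = a , b , c , rest , ↭-refl , h
    ... | no ¬h with z , z∈ , ¬light ← find (¬All⇒Any¬ lightest? rest ¬h) with m , p ← ∈⇒↭ z∈
                with weight a b c ≤? weight a b z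
    ... | no lt = replace a b z (≰⇒> lt) (prep a (prep b (↭-trans (prep c p) (swap c z ↭-refl))))
    ... | yes le₁ with weight a b c ≤? weight a c z
    ... | no lt = replace a c z (≰⇒> lt)
      (prep a (↭-trans (prep b (prep c p)) (↭-trans (swap b c ↭-refl) (prep c (swap b z ↭-refl)))))
    ... | yes le₂ with weight a b c ≤? weight b c z
    ... | no lt = replace b c z (≰⇒> lt)
      (↭-trans (prep a (prep b (prep c p)))
        (↭-trans (swap a b ↭-refl) (prep b (↭-trans (swap a c ↭-refl) (prep c (swap a z ↭-refl))))))
    ... | yes le₃ = contradiction (light le₁ le₂ le₃) ¬light

  module Symmetric (weight-swap₁₂ : ∀ a b c → weight a b c ≡ weight b a c)
                   (weight-swap₂₃ : ∀ a b c → weight a b c ≡ weight a c b) where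

    sum₁-swap : ∀ a b l → sum₁ a b l ≡ sum₁ b a l
    sum₁-swap a b []      = refl
    sum₁-swap a b (c ∷ l) = cong₂ _+_ (weight-swap₁₂ a b c) (sum₁-swap a b l)

    sum₁-↭ : ∀ a b {l m} → l ↭ m → sum₁ a b l ≡ sum₁ a b m
    sum₁-↭ a b Perm.refl = refl
    sum₁-↭ a b (prep x p) = cong (weight a b x +_) (sum₁-↭ a b p)
    sum₁-↭ a b {m = _ ∷ _ ∷ m} (swap x y p) rewrite sum₁-↭ a b p =
      x∙yz≈y∙xz +-commutativeSemigroup (weight a b x) (weight a b y) (sum₁ a b m)
    sum₁-↭ a b (Perm.trans p q) = trans (sum₁-↭ a b p) (sum₁-↭ a b q)

    sum₂-↭ : ∀ a {l m} → l ↭ m → sum₂ a l ≡ sum₂ a m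
    sum₂-↭ a Perm.refl = refl
    sum₂-↭ a (prep x p) = cong₂ _+_ (sum₁-↭ a x p) (sum₂-↭ a p)
    sum₂-↭ a {m = _ ∷ _ ∷ m} (swap x y p)
      rewrite sum₁-↭ a x p | sum₁-↭ a y p | sum₂-↭ a p | weight-swap₂₃ a x y =
      interchange +-commutativeSemigroup (weight a y x) (sum₁ a x m) (sum₁ a y m) (sum₂ a m)
    sum₂-↭ a (Perm.trans p q) = trans (sum₂-↭ a p) (sum₂-↭ a q)

    sum₃-↭ : ∀ {l m} → l ↭ m → sum₃ l ≡ sum₃ m
    sum₃-↭ Perm.refl = refl
    sum₃-↭ (prep x p) = cong₂ _+_ (sum₂-↭ x p) (sum₃-↭ p)
    sum₃-↭ {m = _ ∷ _ ∷ m} (swap x y p)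
      rewrite sum₁-↭ x y p | sum₂-↭ x p | sum₂-↭ y p | sum₃-↭ p | sum₁-swap x y m =
      interchange +-commutativeSemigroup (sum₁ y x m) (sum₂ x m) (sum₂ y m) (sum₃ m)
    sum₃-↭ (Perm.trans p q) = trans (sum₃-↭ p) (sum₃-↭ q)

    Lightest-swap₁₂ : ∀ {a b c z} → Lightest a b c z → Lightest b a c z
    Lightest-swap₁₂ {a} {b} {c} {z} (light p q r) = light
      (subst₂ _≤_ (weight-swap₁₂ a b c) (weight-swap₁₂ a b z) p)
      (≤-trans (≤-reflexive (weight-swap₁₂ b a c)) r)
      (≤-trans (≤-reflexive (weight-swap₁₂ b a c)) q)

    Lightest-swap₂₃ : ∀ {a b c z} → Lightest a b c z → Lightest a c b z
    Lightest-swap₂₃ {a} {b} {c} {z} (light p q r) = light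
      (≤-trans (≤-reflexive (weight-swap₂₃ a c b)) q)
      (≤-trans (≤-reflexive (weight-swap₂₃ a c b)) p)
      (subst₂ _≤_ (weight-swap₂₃ a b c) (weight-swap₁₂ b c z) r)

  module Invariant (g : ℕ → ℕ) (weight-map : ∀ a b c → weight (g a) (g b) (g c) ≡ weight a b c) where

    sum₁-map : ∀ a b l → sum₁ (g a) (g b) (map g l) ≡ sum₁ a b l
    sum₁-map a b []      = refl
    sum₁-map a b (c ∷ l) = cong₂ _+_ (weight-map a b c) (sum₁-map a b l)

    sum₂-map : ∀ a l → sum₂ (g a) (map g l) ≡ sum₂ a l
    sum₂-map a []      = refl
    sum₂-map a (b ∷ l) = cong₂ _+_ (sum₁-map a b l) (sum₂-map a l)

    sum₃-map : ∀ l → sum₃ (map g l) ≡ sum₃ l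
    sum₃-map []      = refl
    sum₃-map (a ∷ l) = cong₂ _+_ (sum₂-map a l) (sum₃-map l)

    Lightest-map : ∀ {a b c z} → Lightest a b c z → Lightest (g a) (g b) (g c) (g z)
    Lightest-map {a} {b} {c} {z} (light p q r) = light
      (subst₂ _≤_ (sym (weight-map a b c)) (sym (weight-map a b z)) p)
      (subst₂ _≤_ (sym (weight-map a b c)) (sym (weight-map a c z)) q)
      (subst₂ _≤_ (sym (weight-map a b c)) (sym (weight-map b c z)) r)

-- Colourings by sums of weights

-- W tabulates the weights of the triples 0, x, y, at index 71 x + y, and B tabulates the
-- colours. The intended values of the other parameters are the residues modulo 71, the
-- multiplicative order 35 of 2, and a list reps such that every triple can be moved
-- to 0, 1, r with r in reps. Leaving them variable keeps the finite checks below
-- unevaluated wherever their consequences are derived.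
module TripleColouring (residues : List ℕ) (order : ℕ) (reps : List ℕ) (W : Tree ℕ) (B : Tree Colour) where

  pairWeight : ℕ → ℕ → ℕ
  pairWeight x y = get W (x * 71 + y)

  weight : ℕ → ℕ → ℕ → ℕ
  weight a b c = pairWeight (diff a b) (diff a c)

  open TripleSum weight using (sum₃; Lightest; light; lightest-triple)

  -- The colour of a set, given as a list of its elements.
  colour : List ℕ → Colour
  colour l = get B (sum₃ l % 16384)

  -- All lists obtained from t by deleting one entry have colour c.
  Mono : Colour → List ℕ → Set
  Mono c t = ∀ x l → x ∷ l ↭ t → colour l ≡ c

  Mono-resp-↭ : ∀ {c t u} → t ↭ u → Mono c t → Mono c u
  Mono-resp-↭ p mono x l q = mono x l (↭-trans q (↭-sym p))

  Mono-⊆ : ∀ {c t} → length t ≡ 6 → Mono c t → ∀ l m → length l ≡ 5 → l ++ m ↭ t → colour l ≡ c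
  Mono-⊆ {t = t} ∣t∣ mono l m ∣l∣ p = singleton m ∣m∣ p
    where
    ∣m∣ : length m ≡ 1
    ∣m∣ = +-cancelˡ-≡ 5 _ _
      (trans (cong (_+ length m) (sym ∣l∣)) (trans (sym (length-++ l)) (trans (↭-length p) ∣t∣)))
    singleton : ∀ m → length m ≡ 1 → l ++ m ↭ t → colour l ≡ _
    singleton (x ∷ []) refl q = mono x l
      (↭-trans (prep x (↭-reflexive (sym (++-identityʳ l)))) (↭-trans (↭-sym (shift x l [])) q))

  -- Every 5-set formed by z, y and three points of base has colour c.
  extends : Colour → List ℕ → ℕ → ℕ → Bool
  extends c base y z = all (λ q → sameColour (colour (z ∷ y ∷ q)) c) (choose 3 base)

  -- No k of the candidates P extend base to a set all of whose 5-subsets have colour c,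
  -- apart from 5-subsets with fewer than two of the k points. The search branches on
  -- whether the first candidate y is used; if so, candidates that form a 5-set of the wrong
  -- colour with y and three points of base are discarded.
  noClique : Colour → ℕ → List ℕ → List ℕ → Bool
  noClique c zero    base P       = false
  noClique c (suc k) base []      = true
  noClique c (suc k) base (y ∷ P) =
    noClique c k (y ∷ base) (filter (λ z → T? (extends c base y z)) P) ∧ noClique c (suc k) base P

  extends-complete : ∀ c base rest y z → length (base ++ rest) ≡ 6 → Mono c (base ++ rest) →
    ∀ {r} → rest ↭ y ∷ z ∷ r → T (extends c base y z)
  extends-complete c base rest y z len mono {r} p = all-complete _ (choose 3 base) λ q q∈ →
    let ∣q∣ , m , q++m↭base = ∈-choose⁻ 3 base q∈ in
    subst (λ d → T (sameColour d c))
      (sym (Mono-⊆ len mono (z ∷ y ∷ q) (m ++ r) (cong (2 +_) ∣q∣) (perm q m q++m↭base)))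
      (sameColour-refl c)
    where
    open PermutationReasoning
    perm : ∀ q m → q ++ m ↭ base → z ∷ y ∷ q ++ (m ++ r) ↭ base ++ rest
    perm q m h = begin
      z ∷ y ∷ q ++ (m ++ r)     ↭⟨ swap z y (↭-sym (++-assoc q m r)) ⟩
      y ∷ z ∷ (q ++ m) ++ r     ↭⟨ prep y (prep z (++⁺ʳ r h)) ⟩
      y ∷ z ∷ base ++ r         ↭⟨ prep y (shift z base r) ⟨
      y ∷ base ++ z ∷ r         ↭⟨ shift y base (z ∷ r) ⟨
      base ++ y ∷ z ∷ r         ↭⟨ ++⁺ˡ base p ⟨
      base ++ rest              ∎

  noClique-sound : ∀ c k base P → T (noClique c k base P) → ∀ rest → length rest ≡ k → Unique rest →
    All (_∈ P) rest → length (base ++ rest) ≡ 6 → ¬ Mono c (base ++ rest)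
  noClique-sound c (suc k) base P₀ t₀ rest len uniq rest⊆₀ total mono = go P₀ t₀ rest⊆₀
    where
    go : ∀ P → T (noClique c (suc k) base P) → All (_∈ P) rest → ⊥
    go [] t rest⊆ = nonempty rest len rest⊆
      where
      nonempty : ∀ l → length l ≡ suc k → ¬ All (_∈ []) l
      nonempty (_ ∷ _) _ (() ∷ _)
    go (y ∷ P) t rest⊆ with y ∈? rest
    ... | no y∉ = go P (proj₂ (Equivalence.to T-∧ t)) (All.tabulate later)
      where
      later : ∀ {z} → z ∈ rest → z ∈ P
      later z∈ with All.lookup rest⊆ z∈
      ... | here refl = contradiction z∈ y∉
      ... | there z∈P = z∈P
    ... | yes y∈ with rest′ , p ← ∈⇒↭ y∈ with y≢ ∷ uniq′ ← Unique-resp-↭ p uniq =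
      noClique-sound c k (y ∷ base) _ (proj₁ (Equivalence.to T-∧ t)) rest′ (suc-injective (trans (sym (↭-length p)) len))
        uniq′ (All.tabulate survives) (trans (sym (↭-length moved)) total) (Mono-resp-↭ moved mono)
      where
      moved : base ++ rest ↭ y ∷ base ++ rest′
      moved = ↭-trans (++⁺ˡ base p) (shift y base rest′)
      survives : ∀ {z} → z ∈ rest′ → z ∈ filter (λ z → T? (extends c base y z)) P
      survives {z} z∈ with r , q ← ∈⇒↭ z∈ =
        ∈-filter⁺ (λ z → T? (extends c base y z)) (inP (All.lookup rest⊆ (∈-resp-↭ (↭-sym p) (there z∈))))
          (extends-complete c base rest y z total mono (↭-trans p (prep y q)))
        where
        inP : z ∈ y ∷ P → z ∈ P
        inP (here refl) = contradiction refl (All.lookup y≢ z∈)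
        inP (there z∈P) = z∈P

  -- The weight of a triple is independent of the order of its points, and invariant
  -- under doubling; invariance under translation is built into weight.
  symmetries : Bool
  symmetries = all (λ x → all (λ y → (pairWeight x y ≡ᵇ pairWeight y x)
      ∧ (pairWeight x y ≡ᵇ pairWeight ((x * 70) % 71) ((y + x * 70) % 71))
      ∧ (pairWeight ((x * 2) % 71) ((y * 2) % 71) ≡ᵇ pairWeight x y)) residues) residues

  -- Doubling at most n - 1 times takes u to 1 and, simultaneously, v into reps.
  reach : ℕ → ℕ → ℕ → Bool
  reach zero    u v = false
  reach (suc n) u v = ((u ≡ᵇ 1) ∧ any (v ≡ᵇ_) reps) ∨ reach n ((u * 2) % 71) ((v * 2) % 71)

  -- Some element of G takes a to 0, b to 1 and c into reps.
  normal : ℕ → ℕ → ℕ → Bool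
  normal a b c = reach order (diff a b) (diff a c)

  -- Every triple 0, x, y of distinct residues is normal in one of its six orders.
  normalisable : Bool
  normalisable = all (λ x → all (λ y → (x ≡ᵇ 0) ∨ (y ≡ᵇ 0) ∨ (x ≡ᵇ y)
      ∨ normal 0 x y ∨ normal x y 0 ∨ normal y 0 x ∨ normal x 0 y ∨ normal 0 y x ∨ normal y x 0)
    residues) residues

  lightest : ℕ → ℕ → ℕ → ℕ → Bool
  lightest a b c z = (weight a b c ≤ᵇ weight a b z) ∧ (weight a b c ≤ᵇ weight a c z) ∧ (weight a b c ≤ᵇ weight b c z)

  -- No monochromatic 6-set of colour c contains 0, 1, r as a lightest triple.
  search : Colour → ℕ → Bool
  search c r = noClique c 3 (0 ∷ 1 ∷ r ∷ []) (filter (λ z → T? (lightest 0 1 r z)) residues)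

  searches : Bool
  searches = all (λ r → search red r ∧ search blue r) reps

  -- Elimination of Boolean connectives, with the first operand explicit.
  _∧-elim_ : ∀ x {y} → T (x ∧ y) → T x × T y
  _∧-elim_ x {y} = Equivalence.to (T-∧ {x} {y})

  _∨-elim_ : ∀ x {y} → T (x ∨ y) → T x ⊎ T y
  _∨-elim_ x {y} = Equivalence.to (T-∨ {x} {y})

  _either_or_ : ∀ x {y} → (T x → ⊥) → (T y → ⊥) → T (x ∨ y) → ⊥
  (x either f or g) t = [ f , g ]′ (x ∨-elim t)

  reach-sound : ∀ n u v → u < 71 → v < 71 → T (reach n u v) →
    ∃ λ k → (u * 2 ^ k) % 71 ≡ 1 × (v * 2 ^ k) % 71 ∈ reps
  reach-sound (suc n) u v u< v< t with ((u ≡ᵇ 1) ∧ any (v ≡ᵇ_) reps) ∨-elim t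
  ... | inj₁ now with u≡1 , v∈ ← (u ≡ᵇ 1) ∧-elim now =
    0 , trans (*1-reduced u u<) (≡ᵇ⇒≡ u 1 u≡1)
      , subst (_∈ reps) (sym (*1-reduced v v<)) (Any.map (λ {r} → ≡ᵇ⇒≡ v r) (any⁻ (v ≡ᵇ_) reps v∈))
  ... | inj₂ later with k , p , q ← reach-sound n _ _ (m%n<n (u * 2) 71) (m%n<n (v * 2) 71) later =
    suc k , trans (sym (power-step k u)) p , subst (_∈ reps) (power-step k v) q

  -- Consequences of the finite checks

  module Verified (∈-residues : ∀ {x} → x < 71 → x ∈ residues)
                  (symmetries✓ : symmetries ≡ true) (normalisable✓ : normalisable ≡ true)
                  (searches✓ : searches ≡ true) where

    pairWeight-symmetries : ∀ x y → x < 71 → y < 71 →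
        pairWeight x y ≡ pairWeight y x
      × pairWeight x y ≡ pairWeight ((x * 70) % 71) ((y + x * 70) % 71)
      × pairWeight ((x * 2) % 71) ((y * 2) % 71) ≡ pairWeight x y
    pairWeight-symmetries x y x< y<
      with p , qr ← (pairWeight x y ≡ᵇ pairWeight y x)
             ∧-elim all-sound _ residues (all-sound _ residues (≡true⇒T symmetries✓) (∈-residues x<)) (∈-residues y<)
      with q , r ← (pairWeight x y ≡ᵇ pairWeight ((x * 70) % 71) ((y + x * 70) % 71)) ∧-elim qr =
      ≡ᵇ⇒≡ (pairWeight x y) _ p , ≡ᵇ⇒≡ (pairWeight x y) _ q , ≡ᵇ⇒≡ _ (pairWeight x y) r

    pairWeight-power : ∀ k x y → x < 71 → y < 71 →
      pairWeight ((x * 2 ^ k) % 71) ((y * 2 ^ k) % 71) ≡ pairWeight x y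
    pairWeight-power zero x y x< y< = cong₂ pairWeight (*1-reduced x x<) (*1-reduced y y<)
    pairWeight-power (suc k) x y x< y< =
      trans (sym (cong₂ pairWeight (power-step k x) (power-step k y)))
        (trans (pairWeight-power k _ _ (m%n<n (x * 2) 71) (m%n<n (y * 2) 71))
          (proj₂ (proj₂ (pairWeight-symmetries x y x< y<))))

    weight-swap₂₃ : ∀ a b c → weight a b c ≡ weight a c b
    weight-swap₂₃ a b c = proj₁ (pairWeight-symmetries (diff a b) (diff a c) (diff<71 a b) (diff<71 a c))

    weight-swap₁₂ : ∀ a b c → weight a b c ≡ weight b a c
    weight-swap₁₂ a b c = trans
      (proj₁ (proj₂ (pairWeight-symmetries (diff a b) (diff a c) (diff<71 a b) (diff<71 a c))))
      (cong₂ pairWeight (sym (diff-swap a b)) (diff-shift a b c))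

    weight-affine : ∀ k p a b c → weight (affine k p a) (affine k p b) (affine k p c) ≡ weight a b c
    weight-affine k p a b c = trans
      (cong₂ pairWeight (diff-affine k p a b) (diff-affine k p a c))
      (pairWeight-power k (diff a b) (diff a c) (diff<71 a b) (diff<71 a c))

    open TripleSum weight using (module Symmetric; module Invariant)
    open Symmetric weight-swap₁₂ weight-swap₂₃ using (sum₃-↭; Lightest-swap₁₂; Lightest-swap₂₃)

    colour-↭ : ∀ {l m} → l ↭ m → colour l ≡ colour m
    colour-↭ p = cong (λ n → get B (n % 16384)) (sum₃-↭ p)

    Mono-affine : ∀ k p {c t} → Mono c t → Mono c (map (affine k p) t)
    Mono-affine k p mono x l q with ↭-map-inv (affine k p) (↭-sym q)
    ... | y ∷ l′ , refl , r =
      trans (cong (λ n → get B (n % 16384)) (sum₃-map l′)) (mono y l′ (↭-sym r))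
      where open Invariant (affine k p) (weight-affine k p) using (sum₃-map)

    Lightest⇒lightest : ∀ {a b c z} → Lightest a b c z → T (lightest a b c z)
    Lightest⇒lightest (light p q r) =
      Equivalence.from T-∧ (≤⇒≤ᵇ p , Equivalence.from T-∧ (≤⇒≤ᵇ q , ≤⇒≤ᵇ r))

    search✓ : ∀ c {r} → r ∈ reps → T (search c r)
    search✓ red  {r} r∈ = proj₁ (search red r ∧-elim all-sound _ reps (≡true⇒T searches✓) r∈)
    search✓ blue {r} r∈ = proj₂ (search red r ∧-elim all-sound _ reps (≡true⇒T searches✓) r∈)

    -- After the map g that makes the triple 0, 1, r, the remaining points are candidates of
    -- the search, so the search excludes a monochromatic 6-set.
    normal-impossible : ∀ col a b c rest → length rest ≡ 3 → Distinct (a ∷ b ∷ c ∷ rest) →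
      All (Lightest a b c) rest → T (normal a b c) → ¬ Mono col (a ∷ b ∷ c ∷ rest)
    normal-impossible col a b c rest len (_ ∷ _ ∷ _ ∷ distinct) lights t mono =
      let k , u≡1 , v∈ = reach-sound order (diff a b) (diff a c) (diff<71 a b) (diff<71 a c) t in
      impossible k u≡1 v∈
      where
      impossible : ∀ k → (diff a b * 2 ^ k) % 71 ≡ 1 → (diff a c * 2 ^ k) % 71 ∈ reps → ⊥
      impossible k u≡1 v∈ =
        noClique-sound col 3 (0 ∷ 1 ∷ r ∷ []) _ (search✓ col v∈) (map g rest)
          (trans (length-map g rest) len)
          (AllPairsₚ.map⁺ (AllPairs.map (λ {u} {v} u≢v gu≡gv → u≢v (affine-injective k a u v gu≡gv)) distinct))
          (All-map⁺ (All.map candidate lights))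
          (cong (3 +_) (trans (length-map g rest) len))
          (subst (Mono col) (cong₂ _∷_ ga≡0 (cong₂ _∷_ gb≡1 (cong (_∷ map g rest) gc≡r))) (Mono-affine k a mono))
        where
        g = affine k a
        r = (diff a c * 2 ^ k) % 71
        ga≡0 : g a ≡ 0
        ga≡0 = affine-base k a
        gb≡1 : g b ≡ 1
        gb≡1 = trans (affine-diff k a b) u≡1
        gc≡r : g c ≡ r
        gc≡r = affine-diff k a c
        open Invariant g (weight-affine k a) using (Lightest-map)
        candidate : ∀ {y} → Lightest a b c y → g y ∈ filter (λ z → T? (lightest 0 1 r z)) residues
        candidate {y} l = ∈-filter⁺ (λ z → T? (lightest 0 1 r z)) (∈-residues (m%n<n ((y + a * 70) * 2 ^ k) 71))
          (Lightest⇒lightest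
            (subst (λ u → Lightest u 1 r (g y)) ga≡0
            (subst (λ v → Lightest (g a) v r (g y)) gb≡1
            (subst (λ w → Lightest (g a) (g b) w (g y)) gc≡r (Lightest-map l)))))

    diff≢0 : ∀ a b → a % 71 ≢ b % 71 → ¬ T (diff a b ≡ᵇ 0)
    diff≢0 a b a≢b t = a≢b (diff≡0⇒≡ a b (≡ᵇ⇒≡ (diff a b) 0 t))

    -- One of the six orders of the triple a, b, c is normal. The check is made for the
    -- translated triple 0, x, y; writing 0 as diff a a, the differences within the
    -- translated triple are those within a, b, c by diff-shift.
    lightest-impossible : ∀ col a b c rest → length rest ≡ 3 → Distinct (a ∷ b ∷ c ∷ rest) →
      All (Lightest a b c) rest → ¬ Mono col (a ∷ b ∷ c ∷ rest)
    lightest-impossible col a b c rest len distinct@((a≢b ∷ a≢c ∷ _) ∷ (b≢c ∷ _) ∷ _) lights mono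
      = cases (all-sound _ residues
          (all-sound _ residues (≡true⇒T normalisable✓) (∈-residues (diff<71 a b))) (∈-residues (diff<71 a c)))
      where
      x = diff a b
      y = diff a c
      x≢y : ¬ T (x ≡ᵇ y)
      x≢y t = diff≢0 b c b≢c (subst (λ d → T (d ≡ᵇ 0)) (trans (sym (diff-self x))
        (trans (cong (diff x) (≡ᵇ⇒≡ x y t)) (diff-shift a b c))) _)
      run : ∀ p q r → a ∷ b ∷ c ∷ rest ↭ p ∷ q ∷ r ∷ rest → All (Lightest p q r) rest →
        T (normal (diff a p) (diff a q) (diff a r)) → ⊥
      run p q r perm lights′ t = normal-impossible col p q r rest len (Distinct-resp-↭ perm distinct) lights′
        (subst₂ (λ u v → T (reach order u v)) (diff-shift a p q) (diff-shift a p r) t) (Mono-resp-↭ perm mono)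
      s₁₂ : ∀ {p q r} → All (Lightest p q r) rest → All (Lightest q p r) rest
      s₁₂ = All.map Lightest-swap₁₂
      s₂₃ : ∀ {p q r} → All (Lightest p q r) rest → All (Lightest p r q) rest
      s₂₃ = All.map Lightest-swap₂₃
      p₁₂ : ∀ {p q r} → p ∷ q ∷ r ∷ rest ↭ q ∷ p ∷ r ∷ rest
      p₁₂ = swap _ _ ↭-refl
      p₂₃ : ∀ {p q r} → p ∷ q ∷ r ∷ rest ↭ p ∷ r ∷ q ∷ rest
      p₂₃ = prep _ (swap _ _ ↭-refl)
      at : ∀ (f : ℕ → Bool) → T (f 0) → T (f (diff a a))
      at f = subst (λ d → T (f d)) (sym (diff-self a))
      cases : T ((x ≡ᵇ 0) ∨ (y ≡ᵇ 0) ∨ (x ≡ᵇ y)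
        ∨ normal 0 x y ∨ normal x y 0 ∨ normal y 0 x ∨ normal x 0 y ∨ normal 0 y x ∨ normal y x 0) → ⊥
      cases =
        (x ≡ᵇ 0)     either diff≢0 a b a≢b or
        ((y ≡ᵇ 0)     either diff≢0 a c a≢c or
        ((x ≡ᵇ y)     either x≢y or
        (normal 0 x y either run a b c ↭-refl lights ∘ at (λ d → normal d x y) or
        (normal x y 0 either run b c a (↭-trans p₁₂ p₂₃) (s₂₃ (s₁₂ lights)) ∘ at (λ d → normal x y d) or
        (normal y 0 x either run c a b (↭-trans p₂₃ p₁₂) (s₁₂ (s₂₃ lights)) ∘ at (λ d → normal y d x) or
        (normal x 0 y either run b a c p₁₂ (s₁₂ lights) ∘ at (λ d → normal x d y) or
        (normal 0 y x either run a c b p₂₃ (s₂₃ lights) ∘ at (λ d → normal d y x) or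
        (run c b a (↭-trans p₁₂ (↭-trans p₂₃ p₁₂)) (s₁₂ (s₂₃ (s₁₂ lights))) ∘ at (λ d → normal y x d)))))))))

    no-mono : ∀ col t → length t ≡ 6 → Distinct t → ¬ Mono col t
    no-mono col t@(a ∷ b ∷ c ∷ rest) len distinct mono
      with a′ , b′ , c′ , rest′ , p , lights ← lightest-triple a b c rest (<-wellFounded _) =
      lightest-impossible col a′ b′ c′ rest′ (+-cancelˡ-≡ 3 _ _ (trans (sym (↭-length p)) len))
        (Distinct-resp-↭ p distinct) lights (Mono-resp-↭ p mono)

    -- A list obtained by deleting an entry x from the elements of T₀ is a rearrangement of
    -- the elements of the 5-subset T₀ - x.
    Monochromatic⇒Mono : ∀ {N} (T₀ : Subset N) c → ∣ T₀ ∣ ≡ 6 →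
      Monochromatic {5} (λ (S , _) → colour (elements 0 S)) c T₀ → Mono c (elements 0 T₀)
    Monochromatic⇒Mono T₀ c ∣T∣≡6 mono x l p with R , R⊆T , q ← delete 0 T₀ (∈-resp-↭ p (here refl)) =
      trans (colour-↭ (drop-∷ (↭-trans p (↭-sym q)))) (mono R ∣R∣≡5 R⊆T)
      where
      ∣R∣≡5 : ∣ R ∣ ≡ 5
      ∣R∣≡5 = suc-injective (begin
        suc ∣ R ∣                       ≡⟨ cong suc (length-elements 0 R) ⟨
        suc (length (elements 0 R))     ≡⟨ ↭-length q ⟩
        length (elements 0 T₀)          ≡⟨ length-elements 0 T₀ ⟩
        ∣ T₀ ∣                          ≡⟨ ∣T∣≡6 ⟩
        6                               ∎)
        where open ≡-Reasoning

    monochromatic-impossible : ∀ {N} → N ≤ 71 → (T₀ : Subset N) (c : Colour) → ∣ T₀ ∣ ≡ 6 →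
      ¬ Monochromatic {5} (λ (S , _) → colour (elements 0 S)) c T₀
    monochromatic-impossible N≤71 T₀ c ∣T∣≡6 mono =
      no-mono c (elements 0 T₀) (trans (length-elements 0 T₀) ∣T∣≡6)
        (distinct (All.map (λ x<N → ≤-trans x<N N≤71) (elements-< 0 T₀)) (elements-unique 0 T₀))
        (Monochromatic⇒Mono T₀ c ∣T∣≡6 mono)

    ¬RamseyProperty : ∀ N → N ≤ 71 → ¬ RamseyProperty 5 6 6 N
    ¬RamseyProperty N N≤71 ramsey with ramsey (λ (S , _) → colour (elements 0 S))
    ... | inj₁ (T₀ , ∣T∣≡6 , mono) = monochromatic-impossible N≤71 T₀ red ∣T∣≡6 mono
    ... | inj₂ (T₀ , ∣T∣≡6 , mono) = monochromatic-impossible N≤71 T₀ blue ∣T∣≡6 mono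

-- The tables

-- The tree with entries f 0, …, f (2ᵈ - 1).
tabulate : ∀ {A} → ℕ → (ℕ → A) → Tree A
tabulate zero    f = leaf (f 0)
tabulate (suc d) f = node (2 ^ d) (tabulate d f) (tabulate d (λ i → f (2 ^ d + i)))

-- Entry x is the weight of the triple 0, 1, x. Points 0 and 1, for which the triple
-- degenerates, have weight 0; each other weight occurs for the points x of one G-orbit of triples.
weights : List ℕ
weights =
  0 ∷ 0 ∷ 899 ∷ 1170 ∷ 1177 ∷ 1853 ∷ 2781 ∷ 3001 ∷ 5189 ∷ 5189
  ∷ 5389 ∷ 3001 ∷ 2781 ∷ 5540 ∷ 2781 ∷ 6953 ∷ 8243 ∷ 8789 ∷ 1177 ∷ 6953
  ∷ 10097 ∷ 10435 ∷ 11831 ∷ 11928 ∷ 1170 ∷ 12191 ∷ 8789 ∷ 12452 ∷ 10435 ∷ 12895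
  ∷ 11831 ∷ 8789 ∷ 10097 ∷ 13880 ∷ 12895 ∷ 1170 ∷ 899 ∷ 14112 ∷ 11928 ∷ 10435
  ∷ 8243 ∷ 14576 ∷ 12452 ∷ 11928 ∷ 13880 ∷ 11831 ∷ 14576 ∷ 1177 ∷ 14112 ∷ 12895
  ∷ 12452 ∷ 13880 ∷ 8243 ∷ 1853 ∷ 12191 ∷ 14576 ∷ 10097 ∷ 1853 ∷ 15233 ∷ 3001
  ∷ 15233 ∷ 5540 ∷ 5189 ∷ 5389 ∷ 5389 ∷ 5540 ∷ 15233 ∷ 6953 ∷ 12191 ∷ 14112
  ∷ 899 ∷ []

-- The least x for each of the 23 nonzero weights.
representatives : List ℕ
representatives =
  2 ∷ 3 ∷ 4 ∷ 5 ∷ 6 ∷ 7 ∷ 8 ∷ 10 ∷ 13 ∷ 15 ∷ 16 ∷ 17 ∷ 20 ∷ 21 ∷ 22 ∷ 23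
  ∷ 25 ∷ 27 ∷ 29 ∷ 33 ∷ 37 ∷ 41 ∷ 58 ∷ []

-- The 16384 bits of the colour table, in rows of 256 bits; a set bit means blue. Within a
-- row the least significant bit comes first.
rows : List ℕ
rows =
    0x00004d050050804010c010c882105c01040050e0a00000122000080002090000
  ∷ 0x01c00c08210000a0008092000c4000004000200a824102000081e0200001ac00
  ∷ 0x0002200091440021224000001288404001528010201838110000000120800100
  ∷ 0x30bc40020c0190500030420000480001c0190824120000000128004010884000
  ∷ 0x0407f00180400020201000c42845606006002210141020182208406000ca0014
  ∷ 0x088a204800428009120000a00020400006220a09830700510083440001040000
  ∷ 0x10240c000020000498a102400200c28000440500488000010092006000020004
  ∷ 0x4041150060004800000100140000010030483220100020430001010020000008
  ∷ 0x0046400000008c000008081201000010008020c2100201081a00018810020020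
  ∷ 0x4200a44800810200240000010801200002290008060000000948108410002100
  ∷ 0x440020240008000000840841010000800000844c00108a200000000009002000
  ∷ 0x04c0282012880001240120001008000002080000c68000b240640d5002200820
  ∷ 0x000000000080080442100110052200821404004250000900f00120010012080c
  ∷ 0x000004000010110000024836008008000004040a204404200444102040002000
  ∷ 0x0000000000202102000800000320049406801100010028000000000202240004
  ∷ 0x4a844000441040018580003e0011910080209818082082000600008400008021
  ∷ 0x803009021920006002100840001820202001240001400004000108c404100520
  ∷ 0x120080511002880000200002081002002000001140000440000420204040812a
  ∷ 0x0200050010040002008040204ac0c004400402444090018020100c40080b0000
  ∷ 0x04101160b10028000008110103200888220000002800001000440c0050802844
  ∷ 0x220440004002241020b2000a198000380820c900a80480486100092003e00242
  ∷ 0x0400840010638000000001100040005a2a224404003002000208000200584000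
  ∷ 0x00010242000a0012100040381401040010200000460080008100000840000000
  ∷ 0x20000840098010000040126c8064001429000040800208111060080b0241002c
  ∷ 0x5004000201002143aa41400004800800040200020004080010a00003805d0100
  ∷ 0x405b902040004800005004000002810228031000008522001104000001000210
  ∷ 0x400000400800020008020c01040020024000200804000800b084020841000404
  ∷ 0x00012000000801022000021000000a8004150000020060000000081000083000
  ∷ 0x0015000000004c00024040011810409000401010080008081001c08011410100
  ∷ 0x10484002000e0000480420408040010081442410080000010242440404000141
  ∷ 0x40004830c2800e04e02023084200160000020080000002a06001080450600000
  ∷ 0x1a00308481000650005020904000d09000c08000020080400010087002441100
  ∷ 0x91408a200220008000202100064040603011404206000c020440403800102080
  ∷ 0x4448002011007003000012082110180000142290408840008002440008930000
  ∷ 0x00008000400400528100000a0210020280000004040802510020891008000008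
  ∷ 0x0018204080004000880244000000180040031200002042080003100910101100
  ∷ 0x408008200200a0191000404098000c0014019080000424044044000010460500
  ∷ 0x200300100404800b06010002000052811cc08012080100804000108030280002
  ∷ 0x084b001081112000008202908440404000d1840002100509024c80c000024140
  ∷ 0x2008000000000080002004023085003021803000000850082080000000040050
  ∷ 0x0002044c204200000a0020808200004100000000910000000001000002000000
  ∷ 0x0c0d0050000600040c000005000400c4010120083040140201c0000a44000400
  ∷ 0x9200000002202000810000410020084048000000000008000044420490003a20
  ∷ 0x2000209440510083002820001008400000084840000001100000700020000000
  ∷ 0x7080c000009006210002402042a1000a50024410220088020821000080091008
  ∷ 0x088010800200000a040058208003006000400000411783121010000080100046
  ∷ 0x80002000001200004480005020d800c46200004c000080045540040080254004
  ∷ 0x9403000020000000500001000809003000a4190004210004046010060500c001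
  ∷ 0x0010104040a00810900081048020020822427180200010000000002100a04009
  ∷ 0x1822080405493400080160029004000001404202000140404000002000008000
  ∷ 0x00080a200020802082004118141450100803d0408009a20a9210000840424021
  ∷ 0x0000000022200810000800000000240400600088000801300100024008106088
  ∷ 0x41010082a0005020010000c300280050101c1400428028400089000400080020
  ∷ 0x2400223008020120a08000520024006405850000003048600100020090411404
  ∷ 0x600a090848000010100009040000e01920404200012100005088011022000818
  ∷ 0x002a0019000c08000008204004e0046238800180000000022010000020401000
  ∷ 0x0000805009a44000000025000410824881100000200492040840002c06000000
  ∷ 0x06105400000400000880290921008c201404202804000e02000209810800000a
  ∷ 0x8002200012001008002022120104008410020849200000102408600020400004
  ∷ 0x20800000001010044400000886048086004100200100300000404e8000805421
  ∷ 0x000000088200800c0849200001001104a8010005010205200100000002001000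
  ∷ 0x0109042008010090206e01018009850002220020000210020003008420010408
  ∷ 0x00081040088000002a0100018088000004410000a00406000000201540410094
  ∷ 0x000520000000011002032000107420004000004c0a1008002000010000000200
  ∷ []

nth : List ℕ → ℕ → ℕ
nth []      _       = 0
nth (x ∷ _) zero    = x
nth (_ ∷ l) (suc i) = nth l i

-- The weight of the triple 0, x, y. Some power of 2 takes x to 1 or to -1 = 70; in the
-- latter case translation by 1 moves the triple 0, -1, y to 1, 0, y + 1. The result is 0 if
-- x is 0, or if n steps do not suffice.
doubling : ℕ → ℕ → ℕ → ℕ
doubling zero    x y = 0
doubling (suc n) x y =
  if x ≡ᵇ 1 then nth weights y else
  if x ≡ᵇ 70 then nth weights ((y + 1) % 71) else
  doubling n ((2 * x) % 71) ((2 * y) % 71)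

-- Depth 13 provides 8192 ≥ 71² entries.
weightTree : Tree ℕ
weightTree = tabulate 13 (λ i → doubling 35 (i / 71) (i % 71))

-- The tree of the 2ᵈ binary digits of a number n below 2 ^ 2ᵈ, least significant digit
-- first.
bits : ℕ → ℕ → Tree Colour
bits zero    n = leaf (if n ≡ᵇ 0 then red else blue)
bits (suc d) n = node (2 ^ d)
  (bits d (_%_ n (2 ^ (2 ^ d)) {{m^n≢0 2 (2 ^ d)}}))
  (bits d (_/_ n (2 ^ (2 ^ d)) {{m^n≢0 2 (2 ^ d)}}))

colourTree : Tree Colour
colourTree = bits 14 (foldr (λ r n → r + 2 ^ 256 * n) 0 rows)

-- Verification

symmetries-hold : TripleColouring.symmetries (upTo 71) 35 representatives weightTree colourTree ≡ true
symmetries-hold = refl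

normalisable-holds : TripleColouring.normalisable (upTo 71) 35 representatives weightTree colourTree ≡ true
normalisable-holds = refl

searches-hold : TripleColouring.searches (upTo 71) 35 representatives weightTree colourTree ≡ true
searches-hold = refl

mainTheorem6 : ∀ (r : ℕ) → IsRamseyNumber 5 6 6 r → r ≥ 72
mainTheorem6 r (ramsey , _) = ≮⇒≥ λ { (s≤s r≤71) →
  TripleColouring.Verified.¬RamseyProperty (upTo 71) 35 representatives weightTree colourTree
    ∈-upTo⁺ symmetries-hold normalisable-holds searches-hold r r≤71 ramsey }
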